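{- Let $k\ge1$ be an integer, let $f(x)=ax^2+bx+c$ be a quadratic polynomial with integer coefficients and $a\ge 1$, and let $D=b^2-4ac$. Then, as $n\to\infty$, $$\log \mathrm{lcm}_{0\le i\le k}\{f(n+i)\}=C_{k,D}\log n+o(\log n),$$ where $C_{k,D}=2(k+1)$ if $D\ne a^2i^2$ for all integers $i$ with $1\le i\le k$, and $C_{k,D}=k+i_0+1$ if $D=a^2i_0^2$ for some integer $i_0$ with $1\le i_0\le k$.
   Context: Here $n$ runs over positive integers, and $\mathrm{lcm}_{0\le i\le k}\{f(n+i)\}$ is the (positive) least common multiple of the integers $f(n),f(n+1),\dots,f(n+k)$, which are all nonzero for $n$ sufficiently large. -}

module Defs where

open import Data.Nat.Base as ℕ using (ℕ; zero; suc; s≤s; z≤n)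
import Data.Nat.Properties as ℕₚ
open import Data.Integer.Base as ℤ using (ℤ; +_; 1ℤ)
import Data.Integer.Properties as ℤₚ
import Data.Integer.LCM as ℤ
open import Data.Rational.Base as ℚ
  using (ℚ; mkℚ; 0ℚ; 1ℚ; ½; _/_; _+_; _-_; _*_; -_; ∣_∣; _≤_; _<_; 1/_)
open import Data.Rational.Properties
import Data.Rational.Unnormalised.Base as ℚᵘ
import Data.Rational.Unnormalised.Properties as ℚᵘₚ
open import Data.Rational.Solver using (module +-*-Solver)
open import Data.List.Base using (List; foldr; map; upTo)
open import Data.Product.Base using (∃-syntax; _,_)
open import Data.Sum.Base using (inj₁; inj₂)
open import Relation.Binary.PropositionalEquality

open +-*-Solver using (solve; _:=_; _:+_; _:*_; :-_; _:-_; con)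

Cauchy : (ℕ → ℚ) → Set
Cauchy x = ∀ ε → 0ℚ < ε → ∃[ N ] (∀ m n → N ℕ.≤ m → N ℕ.≤ n → ∣ x m - x n ∣ ≤ ε)

-- No quotient is taken: two sequences denote the same real number when each
-- is ≤ᴿ the other.
record ℝ : Set where
  constructor mkℝ
  field
    seq    : ℕ → ℚ
    cauchy : Cauchy seq

open ℝ public

infix  4 _≤ᴿ_
infixl 6 _-ᴿ_
infixr 7 _·ᴿ_

_≤ᴿ_ : ℝ → ℝ → Set
x ≤ᴿ y = ∀ ε → 0ℚ < ε → ∃[ N ] (∀ n → N ℕ.≤ n → seq x n ≤ seq y n + ε)

0ᴿ : ℝ
0ᴿ = mkℝ (λ _ → 0ℚ) λ ε 0<ε → 0 , λ _ _ _ _ → <⇒≤ 0<ε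

module ℚ-Lemmas where

  0<½* : ∀ ε → 0ℚ < ε → 0ℚ < ½ * ε
  0<½* ε 0<ε = subst (_< ½ * ε) (*-zeroʳ ½) (*-monoʳ-<-pos ½ 0<ε)

  ½+½ : ∀ ε → ½ * ε + ½ * ε ≡ ε
  ½+½ ε = trans (sym (*-distribʳ-+ ε ½ ½)) (*-identityˡ ε)

  ∣∣-sub : ∀ p q → ∣ p - q ∣ ≡ ∣ q - p ∣
  ∣∣-sub p q = trans (cong ∣_∣ (solve 2 (λ p q → p :- q := :- (q :- p)) refl p q))
                     (∣-p∣≡∣p∣ (q - p))

  ∣∣-bound : ∀ p r → p ≤ r → - p ≤ r → ∣ p ∣ ≤ r
  ∣∣-bound p r p≤r -p≤r with ∣p∣≡p∨∣p∣≡-p p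
  ... | inj₁ eq = subst (_≤ r) (sym eq) p≤r
  ... | inj₂ eq = subst (_≤ r) (sym eq) -p≤r

  ≤-+⇒-≤ : ∀ {p q r} → p ≤ q + r → p - r ≤ q
  ≤-+⇒-≤ {p} {q} {r} p≤q+r = ≤-trans (+-monoˡ-≤ (- r) p≤q+r)
    (≤-reflexive (solve 2 (λ q r → q :+ r :- r := q) refl q r))

  ∣∣-diff : ∀ p q → ∣ p ∣ - ∣ q ∣ ≤ ∣ p - q ∣
  ∣∣-diff p q = ≤-+⇒-≤ (≤-trans
    (≤-reflexive (cong ∣_∣ (solve 2 (λ p q → p := p :- q :+ q) refl p q)))
    (∣p+q∣≤∣p∣+∣q∣ (p - q) q))

open ℚ-Lemmas

_-ᴿ_ : ℝ → ℝ → ℝ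
x -ᴿ y = mkℝ (λ n → seq x n - seq y n) λ ε 0<ε →
  let N₁ , h₁ = cauchy x (½ * ε) (0<½* ε 0<ε)
      N₂ , h₂ = cauchy y (½ * ε) (0<½* ε 0<ε)
  in N₁ ℕ.⊔ N₂ , λ m n N≤m N≤n → begin
    ∣ (seq x m - seq y m) - (seq x n - seq y n) ∣
      ≡⟨ cong ∣_∣ (solve 4 (λ p q r s → (p :- q) :- (r :- s) := (p :- r) :- (q :- s))
                   refl (seq x m) (seq y m) (seq x n) (seq y n)) ⟩
    ∣ (seq x m - seq x n) - (seq y m - seq y n) ∣
      ≤⟨ ∣p-q∣≤∣p∣+∣q∣ (seq x m - seq x n) (seq y m - seq y n) ⟩
    ∣ seq x m - seq x n ∣ + ∣ seq y m - seq y n ∣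
      ≤⟨ +-mono-≤ (h₁ m n (ℕₚ.m⊔n≤o⇒m≤o N₁ N₂ N≤m) (ℕₚ.m⊔n≤o⇒m≤o N₁ N₂ N≤n))
                  (h₂ m n (ℕₚ.m⊔n≤o⇒n≤o N₁ N₂ N≤m) (ℕₚ.m⊔n≤o⇒n≤o N₁ N₂ N≤n)) ⟩
    ½ * ε + ½ * ε
      ≡⟨ ½+½ ε ⟩
    ε ∎
  where open ≤-Reasoning

∣_∣ᴿ : ℝ → ℝ
∣ x ∣ᴿ = mkℝ (λ n → ∣ seq x n ∣) λ ε 0<ε →
  let N , h = cauchy x ε 0<ε
  in N , λ m n N≤m N≤n → ≤-trans
    (∣∣-bound (∣ seq x m ∣ - ∣ seq x n ∣) ∣ seq x m - seq x n ∣
      (∣∣-diff (seq x m) (seq x n))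
      (subst₂ _≤_
        (solve 2 (λ p q → q :- p := :- (p :- q)) refl ∣ seq x m ∣ ∣ seq x n ∣)
        (∣∣-sub (seq x n) (seq x m))
        (∣∣-diff (seq x n) (seq x m))))
    (h m n N≤m N≤n)

_·ᴿ_ : ℚ → ℝ → ℝ
q ·ᴿ x = mkℝ (λ n → q * seq x n) λ ε 0<ε →
  let δ       = ε * 1/ r
      0<δ     = subst (_< δ) (*-zeroˡ (1/ r))
                  (*-monoˡ-<-pos (1/ r) {{1/pos⇒pos r}} 0<ε)
      N , h   = cauchy x δ 0<δ
  in N , λ m n N≤m N≤n → begin
    ∣ q * seq x m - q * seq x n ∣
      ≡⟨ cong ∣_∣ (solve 3 (λ q s t → q :* s :- q :* t := q :* (s :- t))
                   refl q (seq x m) (seq x n)) ⟩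
    ∣ q * (seq x m - seq x n) ∣
      ≡⟨ ∣p*q∣≡∣p∣*∣q∣ q (seq x m - seq x n) ⟩
    ∣ q ∣ * ∣ seq x m - seq x n ∣
      ≤⟨ *-monoʳ-≤-nonNeg ∣ seq x m - seq x n ∣ {{∣-∣-nonNeg (seq x m - seq x n)}} ∣q∣≤r ⟩
    r * ∣ seq x m - seq x n ∣
      ≤⟨ *-monoˡ-≤-nonNeg r {{pos⇒nonNeg r}} (h m n N≤m N≤n) ⟩
    r * (ε * 1/ r)
      ≡⟨ solve 3 (λ r ε s → r :* (ε :* s) := ε :* (r :* s)) refl r ε (1/ r) ⟩
    ε * (r * 1/ r)
      ≡⟨ cong (ε *_) (*-inverseʳ r) ⟩
    ε * 1ℚ
      ≡⟨ *-identityʳ ε ⟩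
    ε ∎
  where
  open ≤-Reasoning
  r : ℚ
  r = ∣ q ∣ + 1ℚ
  instance
    r-pos : ℚ.Positive r
    r-pos = nonNeg+pos⇒pos ∣ q ∣ {{∣-∣-nonNeg q}} 1ℚ
    r-nonZero : ℚ.NonZero r
    r-nonZero = pos⇒nonZero r
  ∣q∣≤r : ∣ q ∣ ≤ r
  ∣q∣≤r = subst (_≤ r) (+-identityʳ ∣ q ∣) (+-monoʳ-≤ ∣ q ∣ (<⇒≤ (positive⁻¹ 1ℚ)))

harmonic : ℕ → ℚ
harmonic zero    = 0ℚ
harmonic (suc n) = harmonic n + (+ 1 / suc n)

-- The right-endpoint Riemann sum with mesh 1/N for ∫₁ᵐ dt/t (m, N ≥ 1):
--   Σ_{i=1}^{(m-1)N} (1/N) · 1/(1 + i/N)  =  Σ_{j=N+1}^{mN} 1/j.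
logSum : ℕ → ℕ → ℚ
logSum m N = harmonic (m ℕ.* N) - harmonic N

module LogSumLemmas where

  unit-anti : ∀ {m n} → m ℕ.≤ n → (+ 1 / suc n) ≤ (+ 1 / suc m)
  unit-anti {m} {n} m≤n = toℚᵘ-cancel-≤ (begin
    ℚ.toℚᵘ (+ 1 / suc n)  ≃⟨ toℚᵘ-fromℚᵘ (ℚᵘ.mkℚᵘ (+ 1) n) ⟩
    ℚᵘ.mkℚᵘ (+ 1) n       ≤⟨ ℚᵘ.*≤* (ℤₚ.*-monoˡ-≤-nonNeg (+ 1) (ℤ.+≤+ (s≤s m≤n))) ⟩
    ℚᵘ.mkℚᵘ (+ 1) m       ≃⟨ toℚᵘ-fromℚᵘ (ℚᵘ.mkℚᵘ (+ 1) m) ⟨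
    ℚ.toℚᵘ (+ 1 / suc m)  ∎)
    where open ℚᵘₚ.≤-Reasoning

  infixr 8 _×ℚ_
  _×ℚ_ : ℕ → ℚ → ℚ
  zero  ×ℚ q = 0ℚ
  suc n ×ℚ q = n ×ℚ q + q

  ×ℚ-≃ : ∀ n q → ℚ.toℚᵘ (n ×ℚ q) ℚᵘ.≃ ((+ n) ℚᵘ./ 1) ℚᵘ.* ℚ.toℚᵘ q
  ×ℚ-≃ zero    q = ℚᵘₚ.≃-sym (ℚᵘₚ.*-zeroˡ (ℚ.toℚᵘ q))
  ×ℚ-≃ (suc n) q = begin
    ℚ.toℚᵘ (n ×ℚ q + q)
      ≈⟨ toℚᵘ-homo-+ (n ×ℚ q) q ⟩
    ℚ.toℚᵘ (n ×ℚ q) ℚᵘ.+ Q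
      ≈⟨ ℚᵘₚ.+-cong (×ℚ-≃ n q) (ℚᵘₚ.≃-sym (ℚᵘₚ.*-identityˡ Q)) ⟩
    ((+ n) ℚᵘ./ 1) ℚᵘ.* Q ℚᵘ.+ ℚᵘ.1ℚᵘ ℚᵘ.* Q
      ≈⟨ ℚᵘₚ.*-distribʳ-+ Q ((+ n) ℚᵘ./ 1) ℚᵘ.1ℚᵘ ⟨
    (((+ n) ℚᵘ./ 1) ℚᵘ.+ ℚᵘ.1ℚᵘ) ℚᵘ.* Q
      ≈⟨ ℚᵘₚ.*-congʳ {Q} {((+ n) ℚᵘ./ 1) ℚᵘ.+ ℚᵘ.1ℚᵘ} {(+ suc n) ℚᵘ./ 1} (ℚᵘ.*≡* (cong (ℤ._* + 1)
           (trans (cong (ℤ._+ + 1) (ℤₚ.*-identityʳ (+ n))) (cong +_ (ℕₚ.+-comm n 1))))) ⟩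
    ((+ suc n) ℚᵘ./ 1) ℚᵘ.* Q ∎
    where
    open ℚᵘₚ.≃-Reasoning
    Q = ℚ.toℚᵘ q

  ×ℚ-unit : ∀ m N c → suc c ≡ suc m ℕ.* suc N →
            suc m ×ℚ (+ 1 / suc c) ≡ (+ 1 / suc N)
  ×ℚ-unit m N c eq = toℚᵘ-injective (begin
    ℚ.toℚᵘ (suc m ×ℚ (+ 1 / suc c))
      ≈⟨ ×ℚ-≃ (suc m) (+ 1 / suc c) ⟩
    M ℚᵘ.* ℚ.toℚᵘ (+ 1 / suc c)
      ≈⟨ ℚᵘₚ.*-congˡ {M} (toℚᵘ-fromℚᵘ (ℚᵘ.mkℚᵘ (+ 1) c)) ⟩
    M ℚᵘ.* ℚᵘ.mkℚᵘ (+ 1) c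
      ≈⟨ ℚᵘ.*≡* (cong +_ nat) ⟩
    ℚᵘ.mkℚᵘ (+ 1) N
      ≈⟨ toℚᵘ-fromℚᵘ (ℚᵘ.mkℚᵘ (+ 1) N) ⟨
    ℚ.toℚᵘ (+ 1 / suc N) ∎)
    where
    open ℚᵘₚ.≃-Reasoning
    M = (+ suc m) ℚᵘ./ 1
    nat : suc m ℕ.* 1 ℕ.* suc N ≡ 1 ℕ.* (1 ℕ.* suc c)
    nat = trans (cong (ℕ._* suc N) (ℕₚ.*-identityʳ (suc m)))
            (trans (sym eq) (sym (trans (ℕₚ.*-identityˡ _) (ℕₚ.*-identityˡ _))))

  harmonic-≥ : ∀ x c r → x ℕ.+ r ℕ.≤ suc c →
               harmonic x + r ×ℚ (+ 1 / suc c) ≤ harmonic (r ℕ.+ x)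
  harmonic-≥ x c zero    _ = ≤-reflexive (+-identityʳ (harmonic x))
  harmonic-≥ x c (suc r) le = begin
    harmonic x + (r ×ℚ u + u)          ≡⟨ +-assoc (harmonic x) (r ×ℚ u) u ⟨
    harmonic x + r ×ℚ u + u            ≤⟨ +-mono-≤ (harmonic-≥ x c r (ℕₚ.m≤n⇒m≤1+n le′)) (unit-anti r+x≤c) ⟩
    harmonic (suc r ℕ.+ x)             ∎
    where
    open ≤-Reasoning
    u = + 1 / suc c
    le′ : x ℕ.+ r ℕ.≤ c
    le′ = ℕ.s≤s⁻¹ (subst (ℕ._≤ suc c) (ℕₚ.+-suc x r) le)
    r+x≤c : r ℕ.+ x ℕ.≤ c
    r+x≤c = subst (ℕ._≤ c) (ℕₚ.+-comm x r) le′

  harmonic-≤ : ∀ x c r → c ℕ.≤ x →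
               harmonic (r ℕ.+ x) ≤ harmonic x + r ×ℚ (+ 1 / suc c)
  harmonic-≤ x c zero    _  = ≤-reflexive (sym (+-identityʳ (harmonic x)))
  harmonic-≤ x c (suc r) le = begin
    harmonic (r ℕ.+ x) + (+ 1 / suc (r ℕ.+ x))
      ≤⟨ +-mono-≤ (harmonic-≤ x c r le) (unit-anti (ℕₚ.≤-trans le (ℕₚ.m≤n+m x r))) ⟩
    harmonic x + r ×ℚ u + u
      ≡⟨ +-assoc (harmonic x) (r ×ℚ u) u ⟩
    harmonic x + (r ×ℚ u + u) ∎
    where
    open ≤-Reasoning
    u = + 1 / suc c

  module _ (m : ℕ) where
    a : ℕ → ℚ
    a N = logSum (suc m) (suc N)

    u : ℕ → ℚ
    u N = + 1 / suc N

    a-step : ∀ N → a N ≤ a (suc N)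
    a-step N = begin
      X - Y
        ≡⟨ solve 3 (λ X Y U → X :- Y := (X :+ U) :- (Y :+ U)) refl X Y (u (suc N)) ⟩
      (X + u (suc N)) - (Y + u (suc N))
        ≡⟨ cong (λ z → (X + z) - (Y + u (suc N))) (×ℚ-unit m (suc N) c refl) ⟨
      (X + suc m ×ℚ u c) - (Y + u (suc N))
        ≤⟨ +-monoˡ-≤ (- (Y + u (suc N)))
             (harmonic-≥ (suc m ℕ.* suc N) c (suc m)
               (ℕₚ.≤-reflexive (trans (ℕₚ.+-comm _ (suc m)) (sym (ℕₚ.*-suc (suc m) (suc N)))))) ⟩
      harmonic (suc m ℕ.+ suc m ℕ.* suc N) - (Y + u (suc N))
        ≡⟨ cong (λ z → harmonic z - (Y + u (suc N))) (ℕₚ.*-suc (suc m) (suc N)) ⟨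
      a (suc N) ∎
      where
      open ≤-Reasoning
      X = harmonic (suc m ℕ.* suc N)
      Y = harmonic (suc N)
      c = ℕ.pred (suc m ℕ.* suc (suc N))

    b-step : ∀ N → a (suc N) + u (suc N) ≤ a N + u N
    b-step N = begin
      a (suc N) + u (suc N)
        ≡⟨ cong (λ z → harmonic z - (Y + u (suc N)) + u (suc N)) (ℕₚ.*-suc (suc m) (suc N)) ⟩
      harmonic (suc m ℕ.+ suc m ℕ.* suc N) - (Y + u (suc N)) + u (suc N)
        ≤⟨ +-monoˡ-≤ (u (suc N)) (+-monoˡ-≤ (- (Y + u (suc N)))
             (harmonic-≤ (suc m ℕ.* suc N) c (suc m) (ℕₚ.n≤1+n c))) ⟩
      (X + suc m ×ℚ u c) - (Y + u (suc N)) + u (suc N)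
        ≡⟨ cong (λ z → (X + z) - (Y + u (suc N)) + u (suc N)) (×ℚ-unit m N c refl) ⟩
      (X + u N) - (Y + u (suc N)) + u (suc N)
        ≡⟨ solve 4 (λ X Y U V → (X :+ U) :- (Y :+ V) :+ V := X :- Y :+ U)
             refl X Y (u N) (u (suc N)) ⟩
      a N + u N ∎
      where
      open ≤-Reasoning
      X = harmonic (suc m ℕ.* suc N)
      Y = harmonic (suc N)
      c = ℕ.pred (suc m ℕ.* suc N)

    a-mono : ∀ {M N} → M ℕ.≤′ N → a M ≤ a N
    a-mono ℕ.≤′-refl     = ≤-refl
    a-mono (ℕ.≤′-step {n = n} p) = ≤-trans (a-mono p) (a-step n)

    b-anti : ∀ {M N} → M ℕ.≤′ N → a N + u N ≤ a M + u M
    b-anti ℕ.≤′-refl     = ≤-refl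
    b-anti (ℕ.≤′-step {n = n} p) = ≤-trans (b-step n) (b-anti p)

    0≤u : ∀ N → 0ℚ ≤ u N
    0≤u N = nonNegative⁻¹ (u N) {{normalize-nonNeg 1 (suc N)}}

    gap : ∀ {M N} → M ℕ.≤ N → ∣ a N - a M ∣ ≤ u M
    gap {M} {N} M≤N = ∣∣-bound (a N - a M) (u M)
      (≤-+⇒-≤ (≤-trans (≤-trans
          (subst (_≤ a N + u N) (+-identityʳ (a N)) (+-monoʳ-≤ (a N) (0≤u N)))
          (b-anti (ℕₚ.≤⇒≤′ M≤N)))
        (≤-reflexive (+-comm (a M) (u M)))))
      (≤-trans (≤-reflexive (solve 2 (λ p q → :- (p :- q) := q :- p) refl (a N) (a M)))
        (≤-trans (≤-+⇒-≤ (≤-trans (a-mono (ℕₚ.≤⇒≤′ M≤N)) (≤-reflexive (sym (+-identityˡ (a N))))))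
          (0≤u M)))

  archimedean : ∀ ε → 0ℚ < ε → ∃[ N ] (+ 1 / suc N) ≤ ε
  archimedean (mkℚ (+ zero)      d c) (ℚ.*<* (ℤ.+<+ ()))
  archimedean ε@(mkℚ (+ suc p)   d c) _ = d , toℚᵘ-cancel-≤ (begin
    ℚ.toℚᵘ (+ 1 / suc d)     ≃⟨ toℚᵘ-fromℚᵘ (ℚᵘ.mkℚᵘ (+ 1) d) ⟩
    ℚᵘ.mkℚᵘ (+ 1) d          ≤⟨ ℚᵘ.*≤* (ℤₚ.*-monoʳ-≤-nonNeg (+ suc d) (ℤ.+≤+ (s≤s (z≤n {p})))) ⟩
    ℚᵘ.mkℚᵘ (+ suc p) d      ∎)
    where open ℚᵘₚ.≤-Reasoning
  archimedean (mkℚ ℤ.-[1+ _ ]    d c) (ℚ.*<* ())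

  logSum-cauchy : ∀ m → Cauchy (logSum (suc m))
  logSum-cauchy m ε 0<ε with archimedean ε 0<ε
  ... | K , 1/K≤ε = suc K , h
    where
    h : ∀ i j → suc K ℕ.≤ i → suc K ℕ.≤ j → ∣ logSum (suc m) i - logSum (suc m) j ∣ ≤ ε
    h (suc i) (suc j) (s≤s K≤i) (s≤s K≤j) with ℕₚ.≤-total i j
    ... | inj₁ i≤j = ≤-trans (≤-reflexive (∣∣-sub (a m i) (a m j)))
                       (≤-trans (gap m i≤j) (≤-trans (unit-anti K≤i) 1/K≤ε))
    ... | inj₂ j≤i = ≤-trans (gap m j≤i) (≤-trans (unit-anti K≤j) 1/K≤ε)

open LogSumLemmas

-- log m = ∫₁ᵐ dt/t for m ≥ 1; log 0 is the junk value 0.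
log : ℕ → ℝ
log zero    = 0ᴿ
log (suc m) = mkℝ (logSum (suc m)) (logSum-cauchy m)

_∈o_ : (ℕ → ℝ) → (ℕ → ℝ) → Set
F ∈o G = ∀ ε → 0ℚ < ε → ∃[ N ] (∀ n → N ℕ.≤ n → ∣ F n ∣ᴿ ≤ᴿ ε ·ᴿ ∣ G n ∣ᴿ)

_≐_+o_ : (ℕ → ℝ) → (ℕ → ℝ) → (ℕ → ℝ) → Set
F ≐ G +o H = (λ n → F n -ᴿ G n) ∈o H

quadratic : ℤ → ℤ → ℤ → ℤ → ℤ
quadratic a b c x = a ℤ.* x ℤ.^ 2 ℤ.+ b ℤ.* x ℤ.+ c

discriminant : ℤ → ℤ → ℤ → ℤ
discriminant a b c = b ℤ.^ 2 ℤ.- + 4 ℤ.* a ℤ.* c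

-- The library's lcm on ℤ is nonnegative, and is 0 when an argument is 0.
lcmConsecutive : (ℤ → ℤ) → ℕ → ℕ → ℤ
lcmConsecutive f k n = foldr ℤ.lcm 1ℤ (map (λ i → f (+ (n ℕ.+ i))) (upTo (suc k)))

-- With the convention log 0 = 0, this still forces the lcm to be nonzero for
-- large n when C > 0.
LogLcmAsymptotic : (ℤ → ℤ) → ℕ → ℕ → Set
LogLcmAsymptotic f k C =
  (λ n → log ℤ.∣ lcmConsecutive f k n ∣) ≐ (λ n → (+ C / 1) ·ᴿ log n) +o log

module Submission where

-- The pairwise gcds of suitable "atoms" y(n), y(n+1), …, y(n+m-1) are bounded
-- independently of n, so the lcm of the f(n+i) agrees with the product of the
-- atoms up to a constant factor, and its logarithm is m · deg y · log n + O(1).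
-- If D ≠ a²i² for 1 ≤ i ≤ k, the atoms are the values f(n+i) themselves: the
-- resultant of f(x) and f(x+d) is a nonzero multiple of a²d² − D.
-- If D = a²i₀², then 4a f(x) = ℓ(x) ℓ(x+i₀) with ℓ linear, and the atoms are the
-- k+i₀+1 values ℓ(n), …, ℓ(n+k+i₀), any two of which differ by 2ad.
-- The term O(1) = log K needs no bound on log K: it is at most ε log n as soon as
-- n ≥ Kᵗ with t ≥ 1/ε.

open import Defs
open import Data.Nat.Base as ℕ using (ℕ; zero; suc; z≤n; s≤s; s≤s⁻¹)
import Data.Nat.Properties as ℕₚ
import Data.Nat.Divisibility as ℕᵈ
open import Data.Integer.Base as ℤ using (ℤ; +_; 0ℤ; 1ℤ; -1ℤ)
import Data.Integer.Properties as ℤₚ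
import Data.Integer.LCM as ℤᴸ
import Data.Integer.Solver as ℤS
open import Data.Integer.Divisibility.Signed
import Data.Rational.Base as ℚ
import Data.Rational.Properties as ℚₚ
import Data.Rational.Solver as ℚS
import Data.Rational.Unnormalised.Base as ℚᵘ
import Data.Rational.Unnormalised.Properties as ℚᵘₚ
open import Data.List.Base using (List; []; _∷_; foldr)
open import Data.List.Membership.Propositional using (_∈_)
open import Data.List.Membership.Propositional.Properties using (∈-map⁺; ∈-map⁻; ∈-upTo⁺; ∈-upTo⁻)
open import Data.List.Relation.Unary.Any using (here; there)
open import Data.Product.Base using (_×_; _,_; ∃-syntax; proj₁; proj₂)
open import Data.Sum.Base using (inj₁; inj₂; [_,_]′)
open import Function.Base using (_∘_; it)
open import Relation.Nullary.Decidable using (yes; no)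
open import Relation.Binary.PropositionalEquality

-- Logarithm laws for the Riemann sums, with explicit mesh errors.

module LogSumBounds where

  open LogSumLemmas using (_×ℚ_; ×ℚ-≃; ×ℚ-unit; unit-anti; archimedean; a-mono; b-anti; 0≤u)
  open ℚ-Lemmas using (∣∣-bound; ≤-+⇒-≤)
  open ℚ using (ℚ; 0ℚ; 1ℚ; _/_; _+_; _-_; _*_; -_; ∣_∣; _≤_)
  open ℚₚ
  open ℚS.+-*-Solver using (solve; _:=_; _:+_; _:*_; :-_; _:-_)

  ×ℚ≡* : ∀ n q → n ×ℚ q ≡ (+ n / 1) * q
  ×ℚ≡* n q = toℚᵘ-injective (begin
    ℚ.toℚᵘ (n ×ℚ q)
      ≈⟨ ×ℚ-≃ n q ⟩
    ((+ n) ℚᵘ./ 1) ℚᵘ.* ℚ.toℚᵘ q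
      ≈⟨ ℚᵘₚ.*-congʳ {ℚ.toℚᵘ q} (toℚᵘ-fromℚᵘ (ℚᵘ.mkℚᵘ (+ n) 0)) ⟨
    ℚ.toℚᵘ (+ n / 1) ℚᵘ.* ℚ.toℚᵘ q
      ≈⟨ toℚᵘ-homo-* (+ n / 1) q ⟨
    ℚ.toℚᵘ ((+ n / 1) * q) ∎)
    where open ℚᵘₚ.≃-Reasoning

  ×ℚ-distribˡ-+ : ∀ n p q → n ×ℚ (p + q) ≡ n ×ℚ p + n ×ℚ q
  ×ℚ-distribˡ-+ n p q = begin
    n ×ℚ (p + q)                     ≡⟨ ×ℚ≡* n (p + q) ⟩
    (+ n / 1) * (p + q)              ≡⟨ *-distribˡ-+ (+ n / 1) p q ⟩
    (+ n / 1) * p + (+ n / 1) * q    ≡⟨ cong₂ _+_ (×ℚ≡* n p) (×ℚ≡* n q) ⟨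
    n ×ℚ p + n ×ℚ q                  ∎
    where open ≡-Reasoning

  ×ℚ-monoʳ-≤ : ∀ n {p q} → p ≤ q → n ×ℚ p ≤ n ×ℚ q
  ×ℚ-monoʳ-≤ zero    p≤q = ≤-refl
  ×ℚ-monoʳ-≤ (suc n) p≤q = +-mono-≤ (×ℚ-monoʳ-≤ n p≤q) p≤q

  p≤∣p∣ : ∀ p → p ≤ ∣ p ∣
  p≤∣p∣ p with ≤-total p 0ℚ
  ... | inj₁ p≤0 = ≤-trans p≤0 (0≤∣p∣ p)
  ... | inj₂ 0≤p = ≤-reflexive (sym (0≤p⇒∣p∣≡p 0≤p))

  harmonic-mono : ∀ {m n} → m ℕ.≤′ n → harmonic m ≤ harmonic n
  harmonic-mono ℕ.≤′-refl             = ≤-refl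
  harmonic-mono (ℕ.≤′-step {n = n} p) = ≤-trans (harmonic-mono p)
    (subst (_≤ harmonic (suc n)) (+-identityʳ (harmonic n)) (+-monoʳ-≤ (harmonic n) (0≤u 0 n)))

  logSum-monoˡ : ∀ {m n} M → m ℕ.≤ n → logSum m M ≤ logSum n M
  logSum-monoˡ M m≤n = +-monoˡ-≤ (- harmonic M) (harmonic-mono (ℕₚ.≤⇒≤′ (ℕₚ.*-monoˡ-≤ M m≤n)))

  logSum-monoʳ : ∀ m .{{_ : ℕ.NonZero m}} {M N} → suc M ℕ.≤ N → logSum m (suc M) ≤ logSum m N
  logSum-monoʳ (suc m) {N = suc N} (ℕ.s≤s M≤N) = a-mono m (ℕₚ.≤⇒≤′ M≤N)

  -- The sums increase under refinement, but adding one mesh width makes them decrease (`b-anti`). A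
  -- finer sum therefore exceeds a coarser one by at most the coarser mesh width.
  logSum-upper : ∀ m .{{_ : ℕ.NonZero m}} {M N} → suc M ℕ.≤ N →
                 logSum m N ≤ logSum m (suc M) + (+ 1 / suc M)
  logSum-upper (suc m) {M} {suc N} (ℕ.s≤s M≤N) = ≤-trans
    (subst (_≤ logSum (suc m) (suc N) + (+ 1 / suc N)) (+-identityʳ _)
      (+-monoʳ-≤ (logSum (suc m) (suc N)) (0≤u m N)))
    (b-anti m (ℕₚ.≤⇒≤′ M≤N))

  logSum-1 : ∀ M → logSum 1 M ≡ 0ℚ
  logSum-1 M = trans (cong (λ z → harmonic z - harmonic M) (ℕₚ.*-identityˡ M)) (+-inverseʳ (harmonic M))

  -- The harmonic sum splits at `n * M`. This is log(mn) = log m + log n, except that the first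
  -- summand has the refined mesh 1/(nM). Returning to mesh 1/M costs nothing from below and at most
  -- one mesh width from above.
  logSum-* : ∀ m n M → logSum (m ℕ.* n) M ≡ logSum m (n ℕ.* M) + logSum n M
  logSum-* m n M = begin
    harmonic (m ℕ.* n ℕ.* M) - harmonic M
      ≡⟨ cong (λ z → harmonic z - harmonic M) (ℕₚ.*-assoc m n M) ⟩
    harmonic (m ℕ.* (n ℕ.* M)) - harmonic M
      ≡⟨ solve 3 (λ p q r → p :- r := (p :- q) :+ (q :- r)) refl (harmonic (m ℕ.* (n ℕ.* M))) (harmonic (n ℕ.* M)) (harmonic M) ⟩
    logSum m (n ℕ.* M) + logSum n M ∎
    where open ≡-Reasoning

  logSum-*-≥ : ∀ m n .{{_ : ℕ.NonZero m}} .{{_ : ℕ.NonZero n}} M →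
               logSum m (suc M) + logSum n (suc M) ≤ logSum (m ℕ.* n) (suc M)
  logSum-*-≥ m n M = ≤-trans
    (+-monoˡ-≤ (logSum n (suc M)) (logSum-monoʳ m (ℕₚ.m≤n*m (suc M) n)))
    (≤-reflexive (sym (logSum-* m n (suc M))))

  logSum-*-≤ : ∀ m n .{{_ : ℕ.NonZero m}} .{{_ : ℕ.NonZero n}} M →
               logSum (m ℕ.* n) (suc M) ≤ (logSum m (suc M) + (+ 1 / suc M)) + logSum n (suc M)
  logSum-*-≤ m n M = ≤-trans
    (≤-reflexive (logSum-* m n (suc M)))
    (+-monoˡ-≤ (logSum n (suc M)) (logSum-upper m (ℕₚ.m≤n*m (suc M) n)))

  logSum-^-≥ : ∀ n .{{_ : ℕ.NonZero n}} C M → C ×ℚ logSum n (suc M) ≤ logSum (n ℕ.^ C) (suc M)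
  logSum-^-≥ n zero    M = ≤-reflexive (sym (logSum-1 (suc M)))
  logSum-^-≥ n (suc C) M = begin
    C ×ℚ l + l                     ≤⟨ +-monoˡ-≤ l (logSum-^-≥ n C M) ⟩
    logSum (n ℕ.^ C) (suc M) + l   ≡⟨ +-comm _ l ⟩
    l + logSum (n ℕ.^ C) (suc M)   ≤⟨ logSum-*-≥ n (n ℕ.^ C) M ⟩
    logSum (n ℕ.^ suc C) (suc M)   ∎
    where
    open ≤-Reasoning
    instance
      n^C-nonZero : ℕ.NonZero (n ℕ.^ C)
      n^C-nonZero = ℕₚ.m^n≢0 n C
    l = logSum n (suc M)

  -- Each of the `C` factors contributes one mesh width.
  logSum-^-≤ : ∀ n .{{_ : ℕ.NonZero n}} C M →
               logSum (n ℕ.^ C) (suc M) ≤ C ×ℚ (logSum n (suc M) + (+ 1 / suc M))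
  logSum-^-≤ n zero    M = ≤-reflexive (logSum-1 (suc M))
  logSum-^-≤ n (suc C) M = begin
    logSum (n ℕ.^ suc C) (suc M)   ≤⟨ logSum-*-≤ n (n ℕ.^ C) M ⟩
    l + logSum (n ℕ.^ C) (suc M)   ≤⟨ +-monoʳ-≤ l (logSum-^-≤ n C M) ⟩
    l + C ×ℚ l                     ≡⟨ +-comm l (C ×ℚ l) ⟩
    C ×ℚ l + l                     ∎
    where
    open ≤-Reasoning
    instance
      n^C-nonZero : ℕ.NonZero (n ℕ.^ C)
      n^C-nonZero = ℕₚ.m^n≢0 n C
    l = logSum n (suc M) + (+ 1 / suc M)

  -- Two kinds of error appear: log K, which persists as the mesh shrinks, and `suc C` mesh widths,
  -- one for the factor `K` and `C` for the power.
  logSum-near-^ : ∀ n L K .{{_ : ℕ.NonZero n}} .{{_ : ℕ.NonZero L}} .{{_ : ℕ.NonZero K}} C M →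
    n ℕ.^ C ℕ.≤ K ℕ.* L → L ℕ.≤ K ℕ.* n ℕ.^ C →
    ∣ logSum L (suc M) - (+ C / 1) * logSum n (suc M) ∣ ≤ logSum K (suc M) + suc C ×ℚ (+ 1 / suc M)
  logSum-near-^ n L K C M lower upper = subst (λ z → ∣ lL - z ∣ ≤ lK + suc C ×ℚ h) (×ℚ≡* C ln)
    (∣∣-bound (lL - C ×ℚ ln) (lK + suc C ×ℚ h)
      (≤-+⇒-≤ (begin
        lL                                ≤⟨ logSum-monoˡ (suc M) upper ⟩
        logSum (K ℕ.* n ℕ.^ C) (suc M)    ≤⟨ logSum-*-≤ K (n ℕ.^ C) M ⟩
        lK + h + logSum (n ℕ.^ C) (suc M) ≤⟨ +-monoʳ-≤ (lK + h) (logSum-^-≤ n C M) ⟩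
        lK + h + C ×ℚ (ln + h)            ≡⟨ cong (λ z → lK + h + z) (×ℚ-distribˡ-+ C ln h) ⟩
        lK + h + (C ×ℚ ln + C ×ℚ h)
          ≡⟨ solve 4 (λ k h p q → k :+ h :+ (p :+ q) := k :+ (q :+ h) :+ p) refl lK h (C ×ℚ ln) (C ×ℚ h) ⟩
        lK + suc C ×ℚ h + C ×ℚ ln         ∎))
      (begin
        - (lL - C ×ℚ ln)      ≡⟨ solve 2 (λ p q → :- (p :- q) := q :- p) refl lL (C ×ℚ ln) ⟩
        C ×ℚ ln - lL          ≤⟨ ≤-+⇒-≤ (begin
          C ×ℚ ln                      ≤⟨ logSum-^-≥ n C M ⟩
          logSum (n ℕ.^ C) (suc M)     ≤⟨ logSum-monoˡ (suc M) lower ⟩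
          logSum (K ℕ.* L) (suc M)     ≤⟨ logSum-*-≤ K L M ⟩
          lK + h + lL                  ∎) ⟩
        lK + h                ≤⟨ +-monoʳ-≤ lK (subst (_≤ suc C ×ℚ h) (+-identityˡ h) (+-monoˡ-≤ h 0≤C×h)) ⟩
        lK + suc C ×ℚ h       ∎))
    where
    open ≤-Reasoning
    instance
      n^C-nonZero : ℕ.NonZero (n ℕ.^ C)
      n^C-nonZero = ℕₚ.m^n≢0 n C
    h  = + 1 / suc M
    lL = logSum L (suc M)
    ln = logSum n (suc M)
    lK = logSum K (suc M)
    ×ℚ-zeroʳ : ∀ m → m ×ℚ 0ℚ ≡ 0ℚ
    ×ℚ-zeroʳ m = trans (×ℚ≡* m 0ℚ) (*-zeroʳ (+ m / 1))
    0≤C×h : 0ℚ ≤ C ×ℚ h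
    0≤C×h = subst (_≤ C ×ℚ h) (×ℚ-zeroʳ C) (×ℚ-monoʳ-≤ C (0≤u 0 M))

  -- From K^(t+1) ≤ n follows (t+1) log K ≤ log n. Since `logSum-^-≥` carries no mesh error, this
  -- holds at every mesh.
  logSum-≤-ε : ∀ K .{{_ : ℕ.NonZero K}} t ε → (+ 1 / suc t) ≤ ε → ∀ n M → K ℕ.^ suc t ℕ.≤ n →
               logSum K (suc M) ≤ ε * ∣ logSum n (suc M) ∣
  logSum-≤-ε K t ε 1/t≤ε n M Kᵗ≤n = begin
    lK                            ≡⟨ *-identityˡ lK ⟨
    1ℚ * lK                       ≡⟨ cong (_* lK) (trans (sym (×ℚ-unit t 0 t (sym (ℕₚ.*-identityʳ (suc t))))) (×ℚ≡* (suc t) e)) ⟩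
    (+ suc t / 1) * e * lK
      ≡⟨ solve 3 (λ s e l → s :* e :* l := e :* (s :* l)) refl (+ suc t / 1) e lK ⟩
    e * ((+ suc t / 1) * lK)      ≡⟨ cong (e *_) (×ℚ≡* (suc t) lK) ⟨
    e * (suc t ×ℚ lK)
      ≤⟨ *-monoˡ-≤-nonNeg e {{normalize-nonNeg 1 (suc t)}}
          (≤-trans (logSum-^-≥ K (suc t) M) (≤-trans (logSum-monoˡ (suc M) Kᵗ≤n) (p≤∣p∣ ln))) ⟩
    e * ∣ ln ∣                    ≤⟨ *-monoʳ-≤-nonNeg ∣ ln ∣ {{∣-∣-nonNeg ln}} 1/t≤ε ⟩
    ε * ∣ ln ∣                    ∎
    where
    open ≤-Reasoning
    e  = + 1 / suc t
    lK = logSum K (suc M)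
    ln = logSum n (suc M)

  seq-log : ∀ m .{{_ : ℕ.NonZero m}} N → seq (log m) N ≡ logSum m N
  seq-log (suc m) N = refl

  -- The constant factor `K` is absorbed by ε log n; the mesh errors are absorbed by the slack δ in
  -- the definition of `≤ᴿ`, since the mesh is chosen after `n`.
  log-asymptotic : ∀ (L : ℕ → ℕ) C K .{{_ : ℕ.NonZero K}} N →
    (∀ n → N ℕ.≤ n → n ℕ.^ C ℕ.≤ K ℕ.* L n) → (∀ n → N ℕ.≤ n → L n ℕ.≤ K ℕ.* n ℕ.^ C) →
    (λ n → log (L n)) ≐ (λ n → (+ C / 1) ·ᴿ log n) +o log
  log-asymptotic L C K N lower upper ε 0<ε with archimedean ε 0<ε
  -- The sum guarantees at once that `n` is positive, at least `N`, and at least K^(t+1).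
  ... | t , 1/t≤ε = suc N ℕ.+ K ℕ.^ suc t , bound
    where
    bound : ∀ n → suc N ℕ.+ K ℕ.^ suc t ℕ.≤ n →
            ∣ log (L n) -ᴿ ((+ C / 1) ·ᴿ log n) ∣ᴿ ≤ᴿ ε ·ᴿ ∣ log n ∣ᴿ
    bound n@(suc n′) large δ 0<δ with archimedean δ 0<δ
    -- Beyond this index, C+1 mesh widths amount to at most (C+1)/((C+1)(s+1)) = 1/(s+1) ≤ δ.
    ... | s , 1/s≤δ = suc C ℕ.* suc s , λ where
        (suc M) big → begin
          ∣ seq (log (L n)) (suc M) - (+ C / 1) * logSum n (suc M) ∣
            ≡⟨ cong (λ z → ∣ z - (+ C / 1) * logSum n (suc M) ∣) (seq-log (L n) {{L≢0}} (suc M)) ⟩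
          ∣ logSum (L n) (suc M) - (+ C / 1) * logSum n (suc M) ∣
            ≤⟨ logSum-near-^ n (L n) K {{it}} {{L≢0}} C M (lower n N≤n) (upper n N≤n) ⟩
          logSum K (suc M) + suc C ×ℚ (+ 1 / suc M)
            ≤⟨ +-mono-≤ (logSum-≤-ε K t ε 1/t≤ε n M (ℕₚ.m+n≤o⇒n≤o (suc N) large))
                 (≤-trans (×ℚ-monoʳ-≤ (suc C) (unit-anti (ℕ.s≤s⁻¹ big)))
                   (≤-trans (≤-reflexive (×ℚ-unit C s _ refl)) 1/s≤δ)) ⟩
          ε * ∣ logSum n (suc M) ∣ + δ ∎
      where
      open ≤-Reasoning
      N≤n : N ℕ.≤ n
      N≤n = ℕₚ.≤-trans (ℕₚ.n≤1+n N) (ℕₚ.m+n≤o⇒m≤o (suc N) large)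
      -- Rules out the junk value of `log` at 0: 1 ≤ n^C ≤ K · L n.
      L≢0 : ℕ.NonZero (L n)
      L≢0 = ℕₚ.m*n≢0⇒n≢0 K {{ℕ.>-nonZero (ℕₚ.≤-trans (ℕₚ.m^n>0 n C) (lower n N≤n))}}

-- Bézout certificates and divisibility of products.

open LogSumBounds using (log-asymptotic)
open import Data.Integer.Base using (∣_∣)
open ℤS.+-*-Solver using (solve; _:=_; _:+_; _:*_; _:-_; con; Polynomial)

-- A gcd bound carried by its Bézout certificate, which composes without gcds.
Bézout : ℤ → ℤ → ℤ → Set
Bézout r x y = ∃[ u ] ∃[ v ] u ℤ.* x ℤ.+ v ℤ.* y ≡ r

-- Multiply the two identities: every term of the product contains `x`, except v v′ y z.
bézout-* : ∀ {r s x y z} → Bézout r x y → Bézout s x z → Bézout (r ℤ.* s) x (y ℤ.* z)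
bézout-* {x = x} {y} {z} (u , v , refl) (u′ , v′ , refl) =
  u ℤ.* (u′ ℤ.* x ℤ.+ v′ ℤ.* z) ℤ.+ v ℤ.* y ℤ.* u′ , v ℤ.* v′ ,
  solve 7 (λ u v u′ v′ x y z →
      (u :* (u′ :* x :+ v′ :* z) :+ v :* y :* u′) :* x :+ v :* v′ :* (y :* z)
        := (u :* x :+ v :* y) :* (u′ :* x :+ v′ :* z))
    refl u v u′ v′ x y z

-- In r m = u x m + v y m, replace `m` by a multiple of `y` in the first term and by a multiple of
-- `x` in the second.
bézout⇒*∣ : ∀ {r x y m} → Bézout r x y → x ∣ m → y ∣ m → x ℤ.* y ∣ r ℤ.* m
bézout⇒*∣ {x = x} {y} {m} (u , v , refl) (divides p m≡px) (divides q m≡qy) =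
  divides (u ℤ.* q ℤ.+ v ℤ.* p) (begin
    (u ℤ.* x ℤ.+ v ℤ.* y) ℤ.* m
      ≡⟨ ℤₚ.*-distribʳ-+ m (u ℤ.* x) (v ℤ.* y) ⟩
    u ℤ.* x ℤ.* m ℤ.+ v ℤ.* y ℤ.* m
      ≡⟨ cong₂ (λ s t → u ℤ.* x ℤ.* s ℤ.+ v ℤ.* y ℤ.* t) m≡qy m≡px ⟩
    u ℤ.* x ℤ.* (q ℤ.* y) ℤ.+ v ℤ.* y ℤ.* (p ℤ.* x)
      ≡⟨ solve 6 (λ u v x y p q → u :* x :* (q :* y) :+ v :* y :* (p :* x)
                   := (u :* q :+ v :* p) :* (x :* y)) refl u v x y p q ⟩
    (u ℤ.* q ℤ.+ v ℤ.* p) ℤ.* (x ℤ.* y) ∎)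
  where open ≡-Reasoning

∏ : (ℕ → ℤ) → ℕ → ℤ
∏ x zero    = 1ℤ
∏ x (suc m) = x 0 ℤ.* ∏ (x ∘ suc) m

∏≢0 : ∀ x m → (∀ j → j ℕ.< m → x j ≢ 0ℤ) → ∏ x m ≢ 0ℤ
∏≢0 x zero    x≢0 ()
∏≢0 x (suc m) x≢0 eq =
  [ x≢0 0 (s≤s z≤n) , ∏≢0 (x ∘ suc) m (λ j → x≢0 (suc j) ∘ s≤s) ]′ (ℤₚ.i*j≡0⇒i≡0∨j≡0 (x 0) eq)

∣∏ : ∀ x {m j} → j ℕ.< m → x j ∣ ∏ x m
∣∏ x {suc m} {zero}  _       = ∣m⇒∣m*n _ ∣-refl
∣∏ x {suc m} {suc j} (s≤s p) = ∣n⇒∣m*n (x 0) (∣∏ (x ∘ suc) p)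

*∣∏ : ∀ x {m} i d → i ℕ.+ suc d ℕ.< m → x i ℤ.* x (i ℕ.+ suc d) ∣ ∏ x m
*∣∏ x {suc m} zero    d (s≤s p) = *-monoʳ-∣ (x 0) (∣∏ (x ∘ suc) p)
*∣∏ x {suc m} (suc i) d (s≤s p) = ∣n⇒∣m*n (x 0) (*∣∏ (x ∘ suc) i d p)

bézout-∏ : ∀ {z} r y m → (∀ j → Bézout (r j) z (y j)) → Bézout (∏ r m) z (∏ y m)
bézout-∏ r y zero    _ = 0ℤ , 1ℤ , refl
bézout-∏ r y (suc m) h = bézout-* (h 0) (bézout-∏ (r ∘ suc) (y ∘ suc) m (h ∘ suc))

-- The product of r (j - i - 1) over all pairs i < j < m: `r d` is the certificate for two atoms at
-- distance d + 1, and the factor `∏ r m` collects the pairs containing the first atom.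
defect : (ℕ → ℤ) → ℕ → ℤ
defect r zero    = 1ℤ
defect r (suc m) = ∏ r m ℤ.* defect r m

defect≢0 : ∀ r m → (∀ d → suc d ℕ.< m → r d ≢ 0ℤ) → defect r m ≢ 0ℤ
defect≢0 r zero    r≢0 ()
defect≢0 r (suc m) r≢0 eq =
  [ ∏≢0 r m (λ d → r≢0 d ∘ s≤s) , defect≢0 r m (λ d → r≢0 d ∘ ℕₚ.m<n⇒m<1+n) ]′
    (ℤₚ.i*j≡0⇒i≡0∨j≡0 (∏ r m) eq)

-- Induction splitting off the first atom. Its certificates against the later atoms multiply to one
-- against their whole product, and `bézout⇒*∣` joins the two divisors.
∏∣defect* : ∀ r x m {M} → (∀ i d → Bézout (r d) (x i) (x (i ℕ.+ suc d))) →
            (∀ j → j ℕ.< m → x j ∣ M) → ∏ x m ∣ defect r m ℤ.* M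
∏∣defect* r x zero    {M} bz x∣M = divides (1ℤ ℤ.* M) (sym (ℤₚ.*-identityʳ (1ℤ ℤ.* M)))
∏∣defect* r x (suc m) {M} bz x∣M = subst (∏ x (suc m) ∣_) (sym (ℤₚ.*-assoc (∏ r m) (defect r m) M))
  (bézout⇒*∣ (bézout-∏ r (x ∘ suc) m (bz 0))
    (∣n⇒∣m*n (defect r m) (x∣M 0 (s≤s z≤n)))
    (∏∣defect* r (x ∘ suc) m (bz ∘ suc) (λ j → x∣M (suc j) ∘ s≤s)))

-- Polynomial growth of atoms and of their products.

^-distribʳ-* : ∀ m n e → (m ℕ.* n) ℕ.^ e ≡ m ℕ.^ e ℕ.* n ℕ.^ e
^-distribʳ-* m n zero    = refl
^-distribʳ-* m n (suc e) = trans (cong (m ℕ.* n ℕ.*_) (^-distribʳ-* m n e))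
  (ℕₚ.[m*n]*[o*p]≡[m*o]*[n*p] m n (m ℕ.^ e) (n ℕ.^ e))

∣∏∣-upper : ∀ x m K A → (∀ j → j ℕ.< m → ∣ x j ∣ ℕ.≤ K ℕ.* A) → ∣ ∏ x m ∣ ℕ.≤ K ℕ.^ m ℕ.* A ℕ.^ m
∣∏∣-upper x zero    K A h = ℕₚ.≤-refl
∣∏∣-upper x (suc m) K A h = begin
  ∣ x 0 ℤ.* ∏ (x ∘ suc) m ∣                  ≡⟨ ℤₚ.abs-* (x 0) _ ⟩
  ∣ x 0 ∣ ℕ.* ∣ ∏ (x ∘ suc) m ∣
    ≤⟨ ℕₚ.*-mono-≤ (h 0 (s≤s z≤n)) (∣∏∣-upper (x ∘ suc) m K A (λ j → h (suc j) ∘ s≤s)) ⟩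
  K ℕ.* A ℕ.* (K ℕ.^ m ℕ.* A ℕ.^ m)          ≡⟨ ℕₚ.[m*n]*[o*p]≡[m*o]*[n*p] K A (K ℕ.^ m) (A ℕ.^ m) ⟩
  K ℕ.^ suc m ℕ.* A ℕ.^ suc m                ∎
  where open ℕₚ.≤-Reasoning

∣∏∣-lower : ∀ x m K A → (∀ j → j ℕ.< m → A ℕ.≤ K ℕ.* ∣ x j ∣) → A ℕ.^ m ℕ.≤ K ℕ.^ m ℕ.* ∣ ∏ x m ∣
∣∏∣-lower x zero    K A h = ℕₚ.≤-refl
∣∏∣-lower x (suc m) K A h = begin
  A ℕ.* A ℕ.^ m
    ≤⟨ ℕₚ.*-mono-≤ (h 0 (s≤s z≤n)) (∣∏∣-lower (x ∘ suc) m K A (λ j → h (suc j) ∘ s≤s)) ⟩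
  K ℕ.* ∣ x 0 ∣ ℕ.* (K ℕ.^ m ℕ.* ∣ ∏ (x ∘ suc) m ∣)
    ≡⟨ ℕₚ.[m*n]*[o*p]≡[m*o]*[n*p] K (∣ x 0 ∣) (K ℕ.^ m) _ ⟩
  K ℕ.^ suc m ℕ.* (∣ x 0 ∣ ℕ.* ∣ ∏ (x ∘ suc) m ∣)
    ≡⟨ cong (K ℕ.^ suc m ℕ.*_) (ℤₚ.abs-* (x 0) _) ⟨
  K ℕ.^ suc m ℕ.* ∣ ∏ x (suc m) ∣ ∎
  where open ℕₚ.≤-Reasoning

record GrowsLike (e K N : ℕ) (y : ℕ → ℤ) : Set where
  field
    bounds : ∀ n → N ℕ.≤ n → n ℕ.^ e ℕ.≤ K ℕ.* ∣ y n ∣ × ∣ y n ∣ ℕ.≤ K ℕ.* n ℕ.^ e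

open GrowsLike

-- For j < m and n ≥ 1 one has n + j ≤ m n, so each shifted atom costs an extra factor m^e.
window-upper : ∀ {e K N y} m n → GrowsLike e K N y → N ℕ.≤ n → 1 ℕ.≤ n →
  ∣ ∏ (λ j → y (n ℕ.+ j)) m ∣ ℕ.≤ (K ℕ.* m ℕ.^ e) ℕ.^ m ℕ.* n ℕ.^ (e ℕ.* m)
window-upper {e} {K} {N} {y} m n grows N≤n 1≤n =
  subst (λ z → ∣ ∏ (λ j → y (n ℕ.+ j)) m ∣ ℕ.≤ (K ℕ.* m ℕ.^ e) ℕ.^ m ℕ.* z) (ℕₚ.^-*-assoc n e m)
    (∣∏∣-upper _ m (K ℕ.* m ℕ.^ e) (n ℕ.^ e) λ j j<m → begin
      ∣ y (n ℕ.+ j) ∣               ≤⟨ proj₂ (bounds grows (n ℕ.+ j) (ℕₚ.≤-trans N≤n (ℕₚ.m≤m+n n j))) ⟩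
      K ℕ.* (n ℕ.+ j) ℕ.^ e         ≤⟨ ℕₚ.*-monoʳ-≤ K (ℕₚ.^-monoˡ-≤ e (n+j≤m*n m j j<m)) ⟩
      K ℕ.* (m ℕ.* n) ℕ.^ e         ≡⟨ cong (K ℕ.*_) (^-distribʳ-* m n e) ⟩
      K ℕ.* (m ℕ.^ e ℕ.* n ℕ.^ e)   ≡⟨ ℕₚ.*-assoc K _ _ ⟨
      K ℕ.* m ℕ.^ e ℕ.* n ℕ.^ e     ∎)
  where
  open ℕₚ.≤-Reasoning
  n+j≤m*n : ∀ m j → j ℕ.< m → n ℕ.+ j ℕ.≤ m ℕ.* n
  n+j≤m*n (suc m) j (s≤s j≤m) = ℕₚ.+-monoʳ-≤ n
    (ℕₚ.≤-trans j≤m (ℕₚ.m≤m*n m n {{ℕ.>-nonZero 1≤n}}))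

window-lower : ∀ {e K N y} m n → GrowsLike e K N y → N ℕ.≤ n →
  n ℕ.^ (e ℕ.* m) ℕ.≤ K ℕ.^ m ℕ.* ∣ ∏ (λ j → y (n ℕ.+ j)) m ∣
window-lower {e} {K} {N} {y} m n grows N≤n =
  subst (ℕ._≤ K ℕ.^ m ℕ.* ∣ ∏ (λ j → y (n ℕ.+ j)) m ∣) (ℕₚ.^-*-assoc n e m)
    (∣∏∣-lower _ m K (n ℕ.^ e) λ j _ → ℕₚ.≤-trans
      (ℕₚ.^-monoˡ-≤ e (ℕₚ.m≤m+n n j))
      (proj₁ (bounds grows (n ℕ.+ j) (ℕₚ.≤-trans N≤n (ℕₚ.m≤m+n n j)))))

-- For n > 2B the remainder is at most half of n^(e+1), while the leading term is at least n^(e+1)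
-- in absolute value; hence n^(e+1) ≤ 2 |y n|. In the constant, 2 serves this lower bound and |α| +
-- B the upper one.
growsLike-leadingTerm : ∀ e (α : ℤ) B (y ρ : ℕ → ℤ) → α ≢ 0ℤ →
  (∀ n → 1 ℕ.≤ n → ∣ ρ n ∣ ℕ.≤ B ℕ.* n ℕ.^ e) →
  (∀ n → y n ≡ α ℤ.* + (n ℕ.^ suc e) ℤ.+ ρ n) →
  GrowsLike (suc e) (2 ℕ.+ (∣ α ∣ ℕ.+ B)) (suc (2 ℕ.* B)) y
bounds (growsLike-leadingTerm e α B y ρ α≢0 ρ≤ y≡) n large = lower , upper
  where
  open ℕₚ.≤-Reasoning
  1≤n : 1 ℕ.≤ n
  1≤n = ℕₚ.≤-trans (s≤s z≤n) large
  instance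
    α-nonZero : ℕ.NonZero ∣ α ∣
    α-nonZero = ℕ.≢-nonZero (α≢0 ∘ ℤₚ.∣i∣≡0⇒i≡0)
    n-nonZero : ℕ.NonZero n
    n-nonZero = ℕ.>-nonZero 1≤n
  p = n ℕ.^ suc e
  q = n ℕ.^ e
  αp = α ℤ.* + p
  ∣αp∣≡ : ∣ αp ∣ ≡ ∣ α ∣ ℕ.* p
  ∣αp∣≡ = ℤₚ.abs-* α (+ p)
  2Bq≤p : 2 ℕ.* (B ℕ.* q) ℕ.≤ p
  2Bq≤p = begin
    2 ℕ.* (B ℕ.* q)  ≡⟨ ℕₚ.*-assoc 2 B q ⟨
    2 ℕ.* B ℕ.* q    ≤⟨ ℕₚ.*-monoˡ-≤ q (ℕₚ.≤-trans (ℕₚ.n≤1+n _) large) ⟩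
    p                ∎
  p≤y+Bq : p ℕ.≤ ∣ y n ∣ ℕ.+ B ℕ.* q
  p≤y+Bq = begin
    p                        ≤⟨ ℕₚ.m≤n*m p ∣ α ∣ ⟩
    ∣ α ∣ ℕ.* p              ≡⟨ ∣αp∣≡ ⟨
    ∣ αp ∣                   ≡⟨ cong ∣_∣ (solve 2 (λ s t → s := s :+ t :- t) refl αp (ρ n)) ⟩
    ∣ αp ℤ.+ ρ n ℤ.- ρ n ∣   ≡⟨ cong (λ z → ∣ z ℤ.- ρ n ∣) (y≡ n) ⟨
    ∣ y n ℤ.- ρ n ∣          ≤⟨ ℤₚ.∣i-j∣≤∣i∣+∣j∣ (y n) (ρ n) ⟩
    ∣ y n ∣ ℕ.+ ∣ ρ n ∣      ≤⟨ ℕₚ.+-monoʳ-≤ ∣ y n ∣ (ρ≤ n 1≤n) ⟩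
    ∣ y n ∣ ℕ.+ B ℕ.* q      ∎
  lower : p ℕ.≤ (2 ℕ.+ (∣ α ∣ ℕ.+ B)) ℕ.* ∣ y n ∣
  lower = ℕₚ.≤-trans
    (ℕₚ.+-cancelʳ-≤ p p (2 ℕ.* ∣ y n ∣) (begin
      p ℕ.+ p                              ≡⟨ cong (p ℕ.+_) (ℕₚ.+-identityʳ p) ⟨
      2 ℕ.* p                              ≤⟨ ℕₚ.*-monoʳ-≤ 2 p≤y+Bq ⟩
      2 ℕ.* (∣ y n ∣ ℕ.+ B ℕ.* q)          ≡⟨ ℕₚ.*-distribˡ-+ 2 ∣ y n ∣ (B ℕ.* q) ⟩
      2 ℕ.* ∣ y n ∣ ℕ.+ 2 ℕ.* (B ℕ.* q)    ≤⟨ ℕₚ.+-monoʳ-≤ (2 ℕ.* ∣ y n ∣) 2Bq≤p ⟩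
      2 ℕ.* ∣ y n ∣ ℕ.+ p                  ∎))
    (ℕₚ.*-monoˡ-≤ ∣ y n ∣ (ℕₚ.m≤m+n 2 (∣ α ∣ ℕ.+ B)))
  upper : ∣ y n ∣ ℕ.≤ (2 ℕ.+ (∣ α ∣ ℕ.+ B)) ℕ.* p
  upper = begin
    ∣ y n ∣                            ≡⟨ cong ∣_∣ (y≡ n) ⟩
    ∣ αp ℤ.+ ρ n ∣                     ≤⟨ ℤₚ.∣i+j∣≤∣i∣+∣j∣ αp (ρ n) ⟩
    ∣ αp ∣ ℕ.+ ∣ ρ n ∣
      ≤⟨ ℕₚ.+-mono-≤ (ℕₚ.≤-reflexive ∣αp∣≡)
           (ℕₚ.≤-trans (ρ≤ n 1≤n) (ℕₚ.*-monoʳ-≤ B (ℕₚ.m≤n*m q n))) ⟩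
    ∣ α ∣ ℕ.* p ℕ.+ B ℕ.* p            ≡⟨ ℕₚ.*-distribʳ-+ p ∣ α ∣ B ⟨
    (∣ α ∣ ℕ.+ B) ℕ.* p                ≤⟨ ℕₚ.*-monoˡ-≤ p (ℕₚ.m≤n+m (∣ α ∣ ℕ.+ B) 2) ⟩
    (2 ℕ.+ (∣ α ∣ ℕ.+ B)) ℕ.* p        ∎

-- The lcm of consecutive values as a least common multiple.

∈⇒∣foldr-lcm : ∀ {x} {xs : List ℤ} → x ∈ xs → x ∣ foldr ℤᴸ.lcm 1ℤ xs
∈⇒∣foldr-lcm {xs = y ∷ ys} (here refl) = ∣ᵤ⇒∣ (ℤᴸ.i∣lcm[i,j] y (foldr ℤᴸ.lcm 1ℤ ys))
∈⇒∣foldr-lcm {xs = y ∷ ys} (there x∈)  = ∣-trans (∈⇒∣foldr-lcm x∈)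
  (∣ᵤ⇒∣ (ℤᴸ.j∣lcm[i,j] y (foldr ℤᴸ.lcm 1ℤ ys)))

foldr-lcm-least : ∀ {m} (xs : List ℤ) → (∀ {x} → x ∈ xs → x ∣ m) → foldr ℤᴸ.lcm 1ℤ xs ∣ m
foldr-lcm-least {m} []       h = divides m (sym (ℤₚ.*-identityʳ m))
foldr-lcm-least {m} (x ∷ xs) h = ∣ᵤ⇒∣ (ℤᴸ.lcm-least {x} {foldr ℤᴸ.lcm 1ℤ xs} {m}
  (∣⇒∣ᵤ (h (here refl))) (∣⇒∣ᵤ (foldr-lcm-least xs (h ∘ there))))

∣lcmConsecutive : ∀ f k n i → i ℕ.≤ k → f (+ (n ℕ.+ i)) ∣ lcmConsecutive f k n
∣lcmConsecutive f k n i i≤k = ∈⇒∣foldr-lcm (∈-map⁺ (λ i → f (+ (n ℕ.+ i))) (∈-upTo⁺ (s≤s i≤k)))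

lcmConsecutive-least : ∀ f k n {m} → (∀ i → i ℕ.≤ k → f (+ (n ℕ.+ i)) ∣ m) → lcmConsecutive f k n ∣ m
lcmConsecutive-least f k n h = foldr-lcm-least _ λ x∈ →
  let i , i∈ , eq = ∈-map⁻ (λ i → f (+ (n ℕ.+ i))) x∈
  in subst (_∣ _) (sym eq) (h i (s≤s⁻¹ (∈-upTo⁻ i∈)))

∣⇒∣∣≤∣∣ : ∀ {x y} → y ≢ 0ℤ → x ∣ y → ∣ x ∣ ℕ.≤ ∣ y ∣
∣⇒∣∣≤∣∣ y≢0 x∣y = ℕᵈ.∣⇒≤ {{ℕ.≢-nonZero (y≢0 ∘ ℤₚ.∣i∣≡0⇒i≡0)}} (∣⇒∣ᵤ x∣y)

*-≢0 : ∀ {x y} → x ≢ 0ℤ → y ≢ 0ℤ → x ℤ.* y ≢ 0ℤ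
*-≢0 {x} x≢0 y≢0 = [ x≢0 , y≢0 ]′ ∘ ℤₚ.i*j≡0⇒i≡0∨j≡0 x

-- Comparison of the lcm with the product of a window of atoms.

module _ (f : ℤ → ℤ) (k : ℕ) {e K N m : ℕ} {s : ℤ} {y r : ℕ → ℤ}
  (s≢0 : s ≢ 0ℤ)
  (r≢0 : ∀ d → suc d ℕ.< m → r d ≢ 0ℤ)
  (bz : ∀ i d → Bézout (r d) (y i) (y (i ℕ.+ suc d)))
  (grows : GrowsLike e K N y)
  (window∣lcm : ∀ n j → j ℕ.< m → y (n ℕ.+ j) ∣ s ℤ.* lcmConsecutive f k n)
  (f∣window : ∀ n i → i ℕ.≤ k → f (+ (n ℕ.+ i)) ∣ ∏ (λ j → y (n ℕ.+ j)) m)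
  where

  private
    L P : ℕ → ℤ
    L = lcmConsecutive f k
    P n = ∏ (λ j → y (n ℕ.+ j)) m

    K₁ K₂ K₃ : ℕ
    K₁ = K ℕ.^ m ℕ.* (∣ defect r m ∣ ℕ.* ∣ s ∣)
    K₂ = (K ℕ.* m ℕ.^ e) ℕ.^ m
    -- A single constant for both directions; `suc` makes it nonzero, as `log-asymptotic` requires.
    K₃ = suc (K₁ ℕ.+ K₂)

    -- Divisibility bounds absolute values only for nonzero multiples. Here n ≥ 1 makes n^(em)
    -- positive, so the lower growth bound excludes a vanishing product.
    P≢0 : ∀ n → suc N ℕ.≤ n → P n ≢ 0ℤ
    P≢0 n@(suc _) N<n Pn≡0 = ℕₚ.<⇒≱ (ℕₚ.m^n>0 n (e ℕ.* m)) (begin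
      n ℕ.^ (e ℕ.* m)       ≤⟨ window-lower m n grows (ℕₚ.<⇒≤ N<n) ⟩
      K ℕ.^ m ℕ.* ∣ P n ∣   ≡⟨ cong (λ z → K ℕ.^ m ℕ.* ∣ z ∣) Pn≡0 ⟩
      K ℕ.^ m ℕ.* 0         ≡⟨ ℕₚ.*-zeroʳ (K ℕ.^ m) ⟩
      0                     ∎)
      where open ℕₚ.≤-Reasoning

    L∣P : ∀ n → L n ∣ P n
    L∣P n = lcmConsecutive-least f k n (f∣window n)

    L≢0 : ∀ n → suc N ℕ.≤ n → L n ≢ 0ℤ
    L≢0 n N<n Ln≡0 = P≢0 n N<n (0∣⇒≡0 (subst (_∣ P n) Ln≡0 (L∣P n)))

    lower : ∀ n → suc N ℕ.≤ n → n ℕ.^ (e ℕ.* m) ℕ.≤ K₃ ℕ.* ∣ L n ∣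
    lower n N<n = begin
      n ℕ.^ (e ℕ.* m)
        ≤⟨ window-lower m n grows (ℕₚ.<⇒≤ N<n) ⟩
      K ℕ.^ m ℕ.* ∣ P n ∣
        -- The certificates depend only on distances between atoms, so the same `defect` works for
        -- every `n` and the constant is uniform.
        ≤⟨ ℕₚ.*-monoʳ-≤ (K ℕ.^ m) (∣⇒∣∣≤∣∣
             (*-≢0 (defect≢0 r m r≢0) (*-≢0 s≢0 (L≢0 n N<n)))
             (∏∣defect* r _ m
               (λ i d → subst (Bézout (r d) (y (n ℕ.+ i)) ∘ y) (ℕₚ.+-assoc n i (suc d)) (bz (n ℕ.+ i) d))
               (window∣lcm n))) ⟩
      K ℕ.^ m ℕ.* ∣ defect r m ℤ.* (s ℤ.* L n) ∣
        ≡⟨ cong (K ℕ.^ m ℕ.*_) (trans (cong ∣_∣ (sym (ℤₚ.*-assoc (defect r m) s (L n))))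
             (trans (ℤₚ.abs-* (defect r m ℤ.* s) (L n)) (cong (ℕ._* ∣ L n ∣) (ℤₚ.abs-* (defect r m) s)))) ⟩
      K ℕ.^ m ℕ.* (∣ defect r m ∣ ℕ.* ∣ s ∣ ℕ.* ∣ L n ∣)
        ≡⟨ ℕₚ.*-assoc (K ℕ.^ m) (∣ defect r m ∣ ℕ.* ∣ s ∣) ∣ L n ∣ ⟨
      K₁ ℕ.* ∣ L n ∣
        ≤⟨ ℕₚ.*-monoˡ-≤ ∣ L n ∣ (ℕₚ.m≤n⇒m≤1+n (ℕₚ.m≤m+n K₁ K₂)) ⟩
      K₃ ℕ.* ∣ L n ∣ ∎
      where open ℕₚ.≤-Reasoning

    upper : ∀ n → suc N ℕ.≤ n → ∣ L n ∣ ℕ.≤ K₃ ℕ.* n ℕ.^ (e ℕ.* m)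
    upper n N<n = begin
      ∣ L n ∣                     ≤⟨ ∣⇒∣∣≤∣∣ (P≢0 n N<n) (L∣P n) ⟩
      ∣ P n ∣                     ≤⟨ window-upper m n grows (ℕₚ.<⇒≤ N<n) (ℕₚ.≤-trans (s≤s z≤n) N<n) ⟩
      K₂ ℕ.* n ℕ.^ (e ℕ.* m)
        ≤⟨ ℕₚ.*-monoˡ-≤ (n ℕ.^ (e ℕ.* m)) (ℕₚ.m≤n⇒m≤1+n (ℕₚ.m≤n+m K₂ K₁)) ⟩
      K₃ ℕ.* n ℕ.^ (e ℕ.* m)      ∎
      where open ℕₚ.≤-Reasoning

  -- `L n` divides `P n`, and `P n` divides a fixed nonzero multiple of `L n`; both are therefore of
  -- order n^(em).
  logLcmAsymptotic-window : LogLcmAsymptotic f k (e ℕ.* m)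
  logLcmAsymptotic-window = log-asymptotic (∣_∣ ∘ L) (e ℕ.* m) K₃ (suc N) lower upper

-- Quadratic polynomials: the two choices of atoms.

-- Spelled the way `x ℤ.^ 2` unfolds, so that solver equations match their goals definitionally.
sq : ∀ {n} → Polynomial n → Polynomial n
sq x = x :* (x :* con 1ℤ)

four-a-quadratic : ∀ a b c x → let t = + 2 ℤ.* a ℤ.* x ℤ.+ b in
  + 4 ℤ.* a ℤ.* quadratic a b c x ≡ t ℤ.* t ℤ.- discriminant a b c
four-a-quadratic = solve 4 (λ a b c x → let t = con (+ 2) :* a :* x :+ b in
  con (+ 4) :* a :* (a :* sq x :+ b :* x :+ c)
    := t :* t :- (sq b :- con (+ 4) :* a :* c)) refl

module _ (a b c : ℤ) (a≢0 : a ≢ 0ℤ) where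

  private
    f : ℤ → ℤ
    f = quadratic a b c

    D : ℤ
    D = discriminant a b c

  quadratic-grows : GrowsLike 2 (2 ℕ.+ (∣ a ∣ ℕ.+ (∣ b ∣ ℕ.+ ∣ c ∣))) (suc (2 ℕ.* (∣ b ∣ ℕ.+ ∣ c ∣))) (f ∘ +_)
  quadratic-grows = growsLike-leadingTerm 1 a (∣ b ∣ ℕ.+ ∣ c ∣) (f ∘ +_) (λ n → b ℤ.* + n ℤ.+ c) a≢0
    (λ n 1≤n → begin
      ∣ b ℤ.* + n ℤ.+ c ∣               ≤⟨ ℤₚ.∣i+j∣≤∣i∣+∣j∣ (b ℤ.* + n) c ⟩
      ∣ b ℤ.* + n ∣ ℕ.+ ∣ c ∣
        ≤⟨ ℕₚ.+-mono-≤ (ℕₚ.≤-reflexive (ℤₚ.abs-* b (+ n))) (ℕₚ.m≤m*n ∣ c ∣ n {{ℕ.>-nonZero 1≤n}}) ⟩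
      ∣ b ∣ ℕ.* n ℕ.+ ∣ c ∣ ℕ.* n       ≡⟨ ℕₚ.*-distribʳ-+ n ∣ b ∣ ∣ c ∣ ⟨
      (∣ b ∣ ℕ.+ ∣ c ∣) ℕ.* n           ≡⟨ cong ((∣ b ∣ ℕ.+ ∣ c ∣) ℕ.*_) (ℕₚ.*-identityʳ n) ⟨
      (∣ b ∣ ℕ.+ ∣ c ∣) ℕ.* n ℕ.^ 1     ∎)
    (λ n → trans (ℤₚ.+-assoc (a ℤ.* (+ n) ℤ.^ 2) (b ℤ.* + n) c)
      (cong (λ z → a ℤ.* z ℤ.+ (b ℤ.* + n ℤ.+ c))
        (sym (trans (ℤₚ.pos-* n (n ℕ.* 1)) (cong (+ n ℤ.*_) (ℤₚ.pos-* n 1))))))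
    where open ℕₚ.≤-Reasoning

  -- The resultant of f(x) and f(x + d + 1), divided by a²(d + 1).
  shiftResultant : ℕ → ℤ
  shiftResultant d = + suc d ℤ.* (a ℤ.^ 2 ℤ.* (+ suc d) ℤ.^ 2 ℤ.- D)

  shiftResultant≢0 : ∀ d → D ≢ a ℤ.^ 2 ℤ.* (+ suc d) ℤ.^ 2 → shiftResultant d ≢ 0ℤ
  shiftResultant≢0 d D≢ = *-≢0 {+ suc d} (λ ()) λ eq → D≢ (sym (ℤₚ.i-j≡0⇒i≡j _ D eq))

  -- With t = 2ax + b, the difference f(x+δ) - f(x) equals δ(t + aδ). Multiplying it by aδ - t gives
  -- δ(a²δ² - t²), and adding 4aδ f(x) = δ(t² - D) eliminates t.
  quadratic-bézout : ∀ i d → Bézout (shiftResultant d) (f (+ i)) (f (+ (i ℕ.+ suc d)))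
  quadratic-bézout i d = + 4 ℤ.* a ℤ.* δ ℤ.+ (t ℤ.- a ℤ.* δ) , a ℤ.* δ ℤ.- t ,
    solve 5 (λ a b c x δ →
        let t  = con (+ 2) :* a :* x :+ b
            f  = λ x → a :* sq x :+ b :* x :+ c
        in (con (+ 4) :* a :* δ :+ (t :- a :* δ)) :* f x :+ (a :* δ :- t) :* f (x :+ δ)
           := δ :* (sq a :* sq δ :- (sq b :- con (+ 4) :* a :* c)))
      refl a b c (+ i) δ
    where
    δ = + suc d
    t = + 2 ℤ.* a ℤ.* + i ℤ.+ b

  logLcmAsymptotic-D≢a²i² : ∀ k → (∀ i → 1 ℕ.≤ i → i ℕ.≤ k → D ≢ a ℤ.^ 2 ℤ.* (+ i) ℤ.^ 2) →
    LogLcmAsymptotic f k (2 ℕ.* (k ℕ.+ 1))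
  logLcmAsymptotic-D≢a²i² k D≢ = logLcmAsymptotic-window f k {e = 2} {m = k ℕ.+ 1} {s = 1ℤ} {r = shiftResultant} (λ ())
    -- Distances within the window run from 1 to `k`, exactly the range of `i` in the hypothesis.
    (λ d d<k → shiftResultant≢0 d (D≢ (suc d) (s≤s z≤n) (<k+1⇒≤k d<k)))
    quadratic-bézout quadratic-grows
    (λ n j j<k+1 → ∣n⇒∣m*n 1ℤ (∣lcmConsecutive f k n j (<k+1⇒≤k j<k+1)))
    (λ n i i≤k → ∣∏ (λ j → f (+ (n ℕ.+ j))) (subst (i ℕ.<_) (ℕₚ.+-comm 1 k) (s≤s i≤k)))
    where
    <k+1⇒≤k : ∀ {j} → j ℕ.< k ℕ.+ 1 → j ℕ.≤ k
    <k+1⇒≤k {j} p = s≤s⁻¹ (subst (j ℕ.<_) (ℕₚ.+-comm k 1) p)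

  module _ (d₀ : ℕ) (D≡ : D ≡ a ℤ.^ 2 ℤ.* (+ suc d₀) ℤ.^ 2) where

    private
      i₀ : ℕ
      i₀ = suc d₀

      β : ℤ
      β = b ℤ.- a ℤ.* + i₀

      ℓ : ℕ → ℤ
      ℓ n = + 2 ℤ.* a ℤ.* + n ℤ.+ β

      2a≢0 : + 2 ℤ.* a ≢ 0ℤ
      2a≢0 = *-≢0 {+ 2} (λ ()) a≢0

      -- Here t² - D = (t - a i₀)(t + a i₀) for t = 2an + b. The choice of `β` makes the first
      -- factor `ℓ n`, and shifting by `i₀` adds 2a i₀, which gives the second.
      ℓ*ℓ : ∀ n → + 4 ℤ.* a ℤ.* f (+ n) ≡ ℓ n ℤ.* ℓ (n ℕ.+ i₀)
      ℓ*ℓ n = trans (four-a-quadratic a b c (+ n))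
        (trans (cong (λ z → t ℤ.* t ℤ.- z) D≡)
          (solve 4 (λ a b x δ →
              let t = con (+ 2) :* a :* x :+ b
                  ℓ = λ x → con (+ 2) :* a :* x :+ (b :- a :* δ)
              in t :* t :- sq a :* sq δ := ℓ x :* ℓ (x :+ δ))
            refl a b (+ n) (+ i₀)))
        where t = + 2 ℤ.* a ℤ.* + n ℤ.+ b

      ℓ-bézout : ∀ i d → Bézout (+ 2 ℤ.* a ℤ.* + suc d) (ℓ i) (ℓ (i ℕ.+ suc d))
      ℓ-bézout i d = -1ℤ , 1ℤ ,
        solve 4 (λ a β x δ →
            let ℓ = λ x → con (+ 2) :* a :* x :+ β
            in con -1ℤ :* ℓ x :+ con 1ℤ :* ℓ (x :+ δ) := con (+ 2) :* a :* δ)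
          refl a β (+ i) (+ suc d)

      ℓ-grows : GrowsLike 1 (2 ℕ.+ (∣ + 2 ℤ.* a ∣ ℕ.+ ∣ β ∣)) (suc (2 ℕ.* ∣ β ∣)) ℓ
      ℓ-grows = growsLike-leadingTerm 0 (+ 2 ℤ.* a) ∣ β ∣ ℓ (λ _ → β) 2a≢0
        (λ n _ → ℕₚ.≤-reflexive (sym (ℕₚ.*-identityʳ ∣ β ∣)))
        (λ n → cong (λ z → + 2 ℤ.* a ℤ.* + z ℤ.+ β) (sym (ℕₚ.*-identityʳ n)))

    logLcmAsymptotic-D≡a²i₀² : ∀ k → i₀ ℕ.≤ k → LogLcmAsymptotic f k (k ℕ.+ i₀ ℕ.+ 1)
    logLcmAsymptotic-D≡a²i₀² k i₀≤k = subst (LogLcmAsymptotic f k) (ℕₚ.*-identityˡ (k ℕ.+ i₀ ℕ.+ 1))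
      (logLcmAsymptotic-window f k {e = 1} {m = k ℕ.+ i₀ ℕ.+ 1} {s = + 4 ℤ.* a} {r = λ d → + 2 ℤ.* a ℤ.* + suc d}
        (*-≢0 {+ 4} (λ ()) a≢0) (λ d _ → *-≢0 2a≢0 λ ()) ℓ-bézout ℓ-grows window∣ f∣)
      where
      m≡ : k ℕ.+ i₀ ℕ.+ 1 ≡ suc k ℕ.+ i₀
      m≡ = ℕₚ.+-comm (k ℕ.+ i₀) 1

      4af∣ : ∀ n i → i ℕ.≤ k → + 4 ℤ.* a ℤ.* f (+ (n ℕ.+ i)) ∣ + 4 ℤ.* a ℤ.* lcmConsecutive f k n
      4af∣ n i i≤k = *-monoʳ-∣ (+ 4 ℤ.* a) (∣lcmConsecutive f k n i i≤k)

      -- For j ≤ k the atom is the first factor of 4a f(n+j). Otherwise i₀ ≤ k < j ≤ k + i₀, and it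
      -- is the second factor of 4a f(n + j - i₀).
      window∣ : ∀ n j → j ℕ.< k ℕ.+ i₀ ℕ.+ 1 → ℓ (n ℕ.+ j) ∣ + 4 ℤ.* a ℤ.* lcmConsecutive f k n
      window∣ n j j<m with j ℕₚ.≤? k
      ... | yes j≤k = ∣-trans
        (subst (ℓ (n ℕ.+ j) ∣_) (sym (ℓ*ℓ (n ℕ.+ j))) (∣m⇒∣m*n (ℓ (n ℕ.+ j ℕ.+ i₀)) ∣-refl))
        (4af∣ n j j≤k)
      ... | no j≰k = ∣-trans
        (subst₂ _∣_ (cong ℓ (trans (ℕₚ.+-assoc n i i₀) (cong (n ℕ.+_) i+i₀≡j))) (sym (ℓ*ℓ (n ℕ.+ i)))
          (∣n⇒∣m*n (ℓ (n ℕ.+ i)) ∣-refl))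
        (4af∣ n i (ℕₚ.+-cancelʳ-≤ i₀ i k (subst (ℕ._≤ k ℕ.+ i₀) (sym i+i₀≡j) (s≤s⁻¹ (subst (j ℕ.<_) m≡ j<m)))))
        where
        i = j ℕ.∸ i₀
        i+i₀≡j : i ℕ.+ i₀ ≡ j
        i+i₀≡j = ℕₚ.m∸n+n≡m (ℕₚ.≤-trans i₀≤k (ℕₚ.<⇒≤ (ℕₚ.≰⇒> j≰k)))

      -- The two factors of 4a f(n+i) sit at different positions of the window because i₀ ≥ 1, so
      -- their product divides the product of all atoms.
      f∣ : ∀ n i → i ℕ.≤ k → f (+ (n ℕ.+ i)) ∣ ∏ (λ j → ℓ (n ℕ.+ j)) (k ℕ.+ i₀ ℕ.+ 1)
      f∣ n i i≤k = ∣-trans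
        (∣n⇒∣m*n (+ 4 ℤ.* a) ∣-refl)
        (subst (_∣ _) (sym (trans (ℓ*ℓ (n ℕ.+ i)) (cong (λ z → ℓ (n ℕ.+ i) ℤ.* ℓ z) (ℕₚ.+-assoc n i i₀))))
          (*∣∏ (λ j → ℓ (n ℕ.+ j)) i d₀
            (subst (i ℕ.+ i₀ ℕ.<_) (sym m≡) (ℕₚ.+-monoˡ-≤ i₀ (s≤s i≤k)))))

theorem1p3 : ∀ (k : ℕ) (a b c : ℤ) → 1 ℕ.≤ k → 1ℤ ℤ.≤ a →
    let f = quadratic a b c
        D = discriminant a b c
    in ((∀ i → 1 ℕ.≤ i → i ℕ.≤ k → D ≢ a ℤ.^ 2 ℤ.* (+ i) ℤ.^ 2) →
          LogLcmAsymptotic f k (2 ℕ.* (k ℕ.+ 1)))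
     × (∀ i₀ → 1 ℕ.≤ i₀ → i₀ ℕ.≤ k → D ≡ a ℤ.^ 2 ℤ.* (+ i₀) ℤ.^ 2 →
          LogLcmAsymptotic f k (k ℕ.+ i₀ ℕ.+ 1))
theorem1p3 k a b c _ 1≤a =
  logLcmAsymptotic-D≢a²i² a b c a≢0 k ,
  λ { (suc d₀) _ i₀≤k D≡ → logLcmAsymptotic-D≡a²i₀² a b c a≢0 d₀ D≡ k i₀≤k }
  where
  a≢0 : a ≢ 0ℤ
  a≢0 refl with () ← ℤₚ.drop‿+≤+ 1≤a
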